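{- For every integer $m\ge3$, $6$ divides $P_m(3)$.
   Context: The Ducci function $D:\mathbb{Z}_m^3\to\mathbb{Z}_m^3$ is $D(x_1,x_2,x_3)=(x_1+x_2,\,x_2+x_3,\,x_3+x_1)$, entries mod $m$. The period $\mathrm{Per}(\mathbf{u})$ is the smallest $k\ge1$ such that $D^{l+k}(\mathbf{u})=D^l(\mathbf{u})$ for some $l\ge0$, and $P_m(3)=\mathrm{Per}(0,0,1)$. -}

module Defs where

open import Data.Fin.Base using (Fin; toℕ; combine)
open import Data.Fin.Properties using (pigeonhole; combine-injective) renaming (_≟_ to _≟ᶠ_)
open import Data.Nat.Base using (ℕ; zero; suc; _+_; _*_; _∸_; _≤_; _<_; NonZero)
open import Data.Nat.DivMod using (_mod_)
open import Data.Nat.GeneralisedArithmetic using (fold; fold-+)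
open import Data.Nat.Induction using (<-rec)
open import Data.Nat.Properties
open import Data.Product.Base using (∃; _×_; _,_; proj₁; proj₂)
open import Data.Product.Properties using (≡-dec)
open import Relation.Binary.Definitions using (DecidableEquality)
open import Relation.Binary.PropositionalEquality
open import Relation.Nullary using (yes; no)
open import Relation.Nullary.Decidable using (_×-dec_) renaming (map′ to mapDec)
open import Relation.Unary using (Decidable)

-- ℤ/m is carried by the canonical residues 0, …, m-1.
ℤₘ³ : ℕ → Set
ℤₘ³ m = Fin m × Fin m × Fin m

module _ {m : ℕ} .{{_ : NonZero m}} where

  infixl 6 _⊕_
  _⊕_ : Fin m → Fin m → Fin m
  x ⊕ y = (toℕ x + toℕ y) mod m

  D : ℤₘ³ m → ℤₘ³ m
  D (x₁ , x₂ , x₃) = x₁ ⊕ x₂ , x₂ ⊕ x₃ , x₃ ⊕ x₁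

  D^ : ℕ → ℤₘ³ m → ℤₘ³ m
  D^ n u = fold u D n

  EventuallyRepeats : ℤₘ³ m → ℕ → Set
  EventuallyRepeats u k = ∃ λ l → D^ (l + k) u ≡ D^ l u

  record IsPeriod (u : ℤₘ³ m) (k : ℕ) : Set where
    field
      positive : 1 ≤ k
      repeats  : EventuallyRepeats u k
      minimal  : ∀ j → 1 ≤ j → EventuallyRepeats u j → k ≤ j

-- Existence of the period: two of the iterates coincide by pigeonhole, say
-- D^ (k₀ + i) u ≡ D^ i u; then EventuallyRepeats u k holds iff it holds with l = i.

least : {P : ℕ → Set} → Decidable P → ∀ n → P n →
        ∃ λ k → P k × (∀ j → P j → k ≤ j)
least {P} P? = <-rec _ step
  where
  step : ∀ n → (∀ {j} → j < n → P j → ∃ λ k → P k × (∀ j → P j → k ≤ j)) →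
         P n → ∃ λ k → P k × (∀ j → P j → k ≤ j)
  step n rec pn with anyUpTo? P? n
  ... | yes (j , j<n , pj) = rec j<n pj
  ... | no ¬smaller = n , pn , λ j pj → ≮⇒≥ λ j<n → ¬smaller (j , j<n , pj)

module _ {m : ℕ} where

  _≟³_ : DecidableEquality (ℤₘ³ m)
  _≟³_ = ≡-dec _≟ᶠ_ (≡-dec _≟ᶠ_ _≟ᶠ_)

  encode : ℤₘ³ m → Fin (m * (m * m))
  encode (x , y , z) = combine x (combine y z)

  encode-injective : ∀ u v → encode u ≡ encode v → u ≡ v
  encode-injective (x , y , z) (x′ , y′ , z′) eq
    with refl , eq′ ← combine-injective x (combine y z) x′ (combine y′ z′) eq
    with refl , refl ← combine-injective y z y′ z′ eq′ = refl

module _ {m : ℕ} .{{_ : NonZero m}} (u : ℤₘ³ m) where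

  D^-+ : ∀ a b → D^ (a + b) u ≡ D^ a (D^ b u)
  D^-+ a b = fold-+ u D a

  cycle : ∃ λ i → ∃ λ k₀ → 1 ≤ k₀ × D^ (k₀ + i) u ≡ D^ i u
  cycle with i , j , i<j , eq ← pigeonhole (n<1+n (m * (m * m))) (λ i → encode (D^ (toℕ i) u))
    = toℕ i , toℕ j ∸ toℕ i , m<n⇒0<n∸m i<j ,
      trans (cong (λ n → D^ n u) (m∸n+n≡m (<⇒≤ i<j)))
            (sym (encode-injective _ _ eq))

  module _ {i k₀ : ℕ} (1≤k₀ : 1 ≤ k₀) (eq₀ : D^ (k₀ + i) u ≡ D^ i u) where

    wrap : ∀ q → D^ (q * k₀ + i) u ≡ D^ i u
    wrap zero    = refl
    wrap (suc q) = begin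
      D^ (k₀ + q * k₀ + i) u     ≡⟨ cong (λ n → D^ n u) (+-assoc k₀ (q * k₀) i) ⟩
      D^ (k₀ + (q * k₀ + i)) u   ≡⟨ D^-+ k₀ (q * k₀ + i) ⟩
      D^ k₀ (D^ (q * k₀ + i) u)  ≡⟨ cong (D^ k₀) (wrap q) ⟩
      D^ k₀ (D^ i u)             ≡⟨ D^-+ k₀ i ⟨
      D^ (k₀ + i) u              ≡⟨ eq₀ ⟩
      D^ i u                     ∎
      where open ≡-Reasoning

    later : ∀ {k l} t → D^ (l + k) u ≡ D^ l u → D^ (t + l + k) u ≡ D^ (t + l) u
    later {k} {l} t eq = begin
      D^ (t + l + k) u      ≡⟨ cong (λ n → D^ n u) (+-assoc t l k) ⟩
      D^ (t + (l + k)) u    ≡⟨ D^-+ t (l + k) ⟩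
      D^ t (D^ (l + k) u)   ≡⟨ cong (D^ t) eq ⟩
      D^ t (D^ l u)         ≡⟨ D^-+ t l ⟨
      D^ (t + l) u          ∎
      where open ≡-Reasoning

    repeatsAt-i : ∀ {k} → EventuallyRepeats u k → D^ (i + k) u ≡ D^ i u
    repeatsAt-i {k} (l , eq) = begin
      D^ (i + k) u               ≡⟨ cong (λ n → D^ n u) (+-comm i k) ⟩
      D^ (k + i) u               ≡⟨ D^-+ k i ⟩
      D^ k (D^ i u)              ≡⟨ cong (D^ k) (wrap l) ⟨
      D^ k (D^ (l * k₀ + i) u)   ≡⟨ D^-+ k (l * k₀ + i) ⟨
      D^ (k + (l * k₀ + i)) u    ≡⟨ cong (λ n → D^ n u) (+-comm k (l * k₀ + i)) ⟩
      D^ (l * k₀ + i + k) u      ≡⟨ cong (λ n → D^ (n + k) u) split ⟨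
      D^ (t + l + k) u           ≡⟨ later t eq ⟩
      D^ (t + l) u               ≡⟨ cong (λ n → D^ n u) split ⟩
      D^ (l * k₀ + i) u          ≡⟨ wrap l ⟩
      D^ i u                     ∎
      where
      open ≡-Reasoning
      t : ℕ
      t = l * k₀ + i ∸ l
      split : t + l ≡ l * k₀ + i
      split = m∸n+n≡m (≤-trans (≤-reflexive (sym (*-identityʳ l)))
                      (≤-trans (*-monoʳ-≤ l 1≤k₀) (m≤m+n (l * k₀) i)))

    eventuallyRepeats? : Decidable (EventuallyRepeats u)
    eventuallyRepeats? k =
      mapDec (i ,_) repeatsAt-i (D^ (i + k) u ≟³ D^ i u)

  period-exists : ∃ (IsPeriod u)
  period-exists
    with i , k₀ , 1≤k₀ , eq₀ ← cycle
    with k , (1≤k , rep) , min ←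
         least (λ k → (1 ≤? k) ×-dec eventuallyRepeats? 1≤k₀ eq₀ k) k₀
               (1≤k₀ , i , trans (cong (λ n → D^ n u) (+-comm i k₀)) eq₀)
    = k , record { positive = 1≤k ; repeats = rep ; minimal = λ j 1≤j r → min j (1≤j , r) }

  Per : ℕ
  Per = proj₁ period-exists

  Per-isPeriod : IsPeriod u Per
  Per-isPeriod = proj₂ period-exists

P₃ : (m : ℕ) .{{_ : NonZero m}} → ℕ
P₃ m = Per {m} (0 mod m , 0 mod m , 1 mod m)

{-# OPTIONS --safe #-}

-- Up to adding a constant vector (c, c, c), the orbit of (0, 0, 1) runs through
-- 001 → 011 → 010 → 110 → 100 → 101 → 001; D only doubles c and adds a carry.
-- If two of these patterns p, q agree mod m up to such a constant, then
-- pᵢ + qⱼ ≡ qᵢ + pⱼ mod m; both sides are at most 2, so for m ≥ 3 the equations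
-- hold in ℕ, which forces p = q.  Hence every repetition length is a multiple of 6.

module Submission where

open import Defs
open import Data.Nat.Base using (ℕ; _≤_; NonZero)
open import Data.Nat.Divisibility using (_∣_)

open import Data.Fin.Base using (Fin; toℕ)
open import Data.Fin.Properties using (all?; fromℕ<-cong; toℕ-fromℕ<) renaming (_≟_ to _≟ᶠ_)
open import Data.Nat.Base using (zero; suc; _+_; _*_; _<_)
open import Data.Nat.Divisibility using (m%n≡0⇒n∣m)
open import Data.Nat.DivMod
open import Data.Nat.Properties
open import Data.Nat.Tactic.RingSolver using (solve-∀)
open import Data.Product.Base using (∃; _,_)
open import Data.Product.Properties using (,-injective)
open import Data.Vec.Base using (lookup; []; _∷_)
open import Relation.Binary.PropositionalEquality
open import Relation.Nullary.Decidable using (from-yes; _→-dec_)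

module _ {m : ℕ} .{{_ : NonZero m}} where

  toℕ-mod : ∀ a → toℕ (a mod m) ≡ a % m
  toℕ-mod a = toℕ-fromℕ< (m%n<n a m)

  mod≡⇒%≡ : ∀ {a b} → a mod m ≡ b mod m → a % m ≡ b % m
  mod≡⇒%≡ {a} {b} eq = trans (sym (toℕ-mod a)) (trans (cong toℕ eq) (toℕ-mod b))

  %≡⇒mod≡ : ∀ {a b} → a % m ≡ b % m → a mod m ≡ b mod m
  %≡⇒mod≡ {a} {b} eq = fromℕ<-cong (a % m) (b % m) eq (m%n<n a m) (m%n<n b m)

  mod-⊕ : ∀ a b → (a mod m) ⊕ (b mod m) ≡ (a + b) mod m
  mod-⊕ a b = %≡⇒mod≡ (begin
    (toℕ (a mod m) + toℕ (b mod m)) % m  ≡⟨ cong₂ (λ x y → (x + y) % m) (toℕ-mod a) (toℕ-mod b) ⟩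
    (a % m + b % m) % m                  ≡⟨ %-distribˡ-+ a b m ⟨
    (a + b) % m                          ∎)
    where open ≡-Reasoning

  %-+-cong : ∀ {a a′ b b′} → a % m ≡ a′ % m → b % m ≡ b′ % m → (a + b) % m ≡ (a′ + b′) % m
  %-+-cong {a} {a′} {b} {b′} p q = begin
    (a + b) % m            ≡⟨ %-distribˡ-+ a b m ⟩
    (a % m + b % m) % m    ≡⟨ cong₂ (λ x y → (x + y) % m) p q ⟩
    (a′ % m + b′ % m) % m  ≡⟨ %-distribˡ-+ a′ b′ m ⟨
    (a′ + b′) % m          ∎
    where open ≡-Reasoning

  -- Both numbers have the same remainder, so `a` minus its multiple of `m` equals `b` minus its
  -- own; moving each multiple across keeps the identity in ℕ.
  %≡⇒+*≡ : ∀ a b → a % m ≡ b % m → a + b / m * m ≡ b + a / m * m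
  %≡⇒+*≡ a b eq = begin
    a + b / m * m                    ≡⟨ cong (_+ b / m * m) (m≡m%n+[m/n]*n a m) ⟩
    a % m + a / m * m + b / m * m    ≡⟨ cong (λ r → r + a / m * m + b / m * m) eq ⟩
    b % m + a / m * m + b / m * m    ≡⟨ swap (b % m) (a / m * m) (b / m * m) ⟩
    b % m + b / m * m + a / m * m    ≡⟨ cong (_+ a / m * m) (m≡m%n+[m/n]*n b m) ⟨
    b + a / m * m                    ∎
    where
    open ≡-Reasoning
    swap : ∀ x y z → x + y + z ≡ x + z + y
    swap = solve-∀

  -- The congruence becomes an equation in ℕ with multiples of `m` added on either side; there `s`
  -- cancels, and the multiples vanish again mod `m`.
  %-+-cancelˡ : ∀ s {t t′} → (s + t) % m ≡ (s + t′) % m → t % m ≡ t′ % m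
  %-+-cancelˡ s {t} {t′} eq = begin
    t % m               ≡⟨ [m+kn]%n≡m%n t y m ⟨
    (t + y * m) % m     ≡⟨ cong (_% m) (+-cancelˡ-≡ s _ _ shifted) ⟩
    (t′ + x * m) % m    ≡⟨ [m+kn]%n≡m%n t′ x m ⟩
    t′ % m              ∎
    where
    open ≡-Reasoning
    x y : ℕ
    x = (s + t) / m
    y = (s + t′) / m
    shifted : s + (t + y * m) ≡ s + (t′ + x * m)
    shifted = trans (sym (+-assoc s t (y * m)))
             (trans (%≡⇒+*≡ (s + t) (s + t′) eq) (+-assoc s t′ (x * m)))

-- Column `r` of the first three tables is the pattern at phase `r` of the 6-cycle. `carry` is 1 at
-- the patterns with two ones, whose coordinate sums are 1 and 2 rather than 0 and 1.
pattern₁ pattern₂ pattern₃ carry : Fin 6 → ℕ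
pattern₁ = lookup (0 ∷ 0 ∷ 0 ∷ 1 ∷ 1 ∷ 1 ∷ [])
pattern₂ = lookup (0 ∷ 1 ∷ 1 ∷ 1 ∷ 0 ∷ 0 ∷ [])
pattern₃ = lookup (1 ∷ 1 ∷ 0 ∷ 0 ∷ 0 ∷ 1 ∷ [])
carry    = lookup (0 ∷ 1 ∷ 0 ∷ 1 ∷ 0 ∷ 1 ∷ [])

next : Fin 6 → Fin 6
next r = suc (toℕ r) mod 6

next-mod : ∀ n → next (n mod 6) ≡ suc n mod 6
next-mod n = %≡⇒mod≡ {a = suc (toℕ (n mod 6))} {b = suc n}
  -- `1 % 6` computes to 1, so distributing `%` over `1 + n` gives the successor of `n % 6`.
  (trans (cong (λ r → suc r % 6) (toℕ-mod n)) (sym (%-distribˡ-+ 1 n 6)))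

pattern₁-next : ∀ r → pattern₁ r + pattern₂ r ≡ carry r + pattern₁ (next r)
pattern₁-next = from-yes (all? λ r → pattern₁ r + pattern₂ r ≟ carry r + pattern₁ (next r))

pattern₂-next : ∀ r → pattern₂ r + pattern₃ r ≡ carry r + pattern₂ (next r)
pattern₂-next = from-yes (all? λ r → pattern₂ r + pattern₃ r ≟ carry r + pattern₂ (next r))

pattern₃-next : ∀ r → pattern₃ r + pattern₁ r ≡ carry r + pattern₃ (next r)
pattern₃-next = from-yes (all? λ r → pattern₃ r + pattern₁ r ≟ carry r + pattern₃ (next r))

pattern₁≤1 : ∀ r → pattern₁ r ≤ 1
pattern₁≤1 = from-yes (all? λ r → pattern₁ r ≤? 1)

pattern₂≤1 : ∀ r → pattern₂ r ≤ 1
pattern₂≤1 = from-yes (all? λ r → pattern₂ r ≤? 1)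

pattern₃≤1 : ∀ r → pattern₃ r ≤ 1
pattern₃≤1 = from-yes (all? λ r → pattern₃ r ≤? 1)

-- The hypotheses compare the differences of adjacent coordinates, written without subtraction.
-- These pairs of differences are (0,-1), (-1,0), (-1,1), (0,1), (1,0), (1,-1), all distinct; the 36
-- cases are decided by evaluation.
patterns-determine-phase : ∀ r s →
  pattern₁ r + pattern₂ s ≡ pattern₁ s + pattern₂ r →
  pattern₂ r + pattern₃ s ≡ pattern₂ s + pattern₃ r → r ≡ s
patterns-determine-phase = from-yes (all? λ r → all? λ s →
  (pattern₁ r + pattern₂ s ≟ pattern₁ s + pattern₂ r) →-dec
  ((pattern₂ r + pattern₃ s ≟ pattern₂ s + pattern₃ r) →-dec (r ≟ᶠ s)))

module _ {m : ℕ} .{{_ : NonZero m}} where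

  shifted : ℕ → Fin 6 → ℤₘ³ m
  shifted c r = (c + pattern₁ r) mod m , (c + pattern₂ r) mod m , (c + pattern₃ r) mod m

  -- One coordinate of `D`, with `e` as the carry, stated so that it serves all three coordinates.
  shifted-sum : ∀ c {p q e s} → p + q ≡ e + s →
    ((c + p) mod m) ⊕ ((c + q) mod m) ≡ (c + c + e + s) mod m
  shifted-sum c {p} {q} {e} {s} eq = trans (mod-⊕ (c + p) (c + q)) (cong (_mod m) (begin
    c + p + (c + q)    ≡⟨ regroup c p q ⟩
    c + c + (p + q)    ≡⟨ cong (c + c +_) eq ⟩
    c + c + (e + s)    ≡⟨ +-assoc (c + c) e s ⟨
    c + c + e + s      ∎))
    where
    open ≡-Reasoning
    regroup : ∀ c p q → c + p + (c + q) ≡ c + c + (p + q)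
    regroup = solve-∀

  D-shifted : ∀ c r → D (shifted c r) ≡ shifted (c + c + carry r) (next r)
  D-shifted c r = cong₂ _,_ (shifted-sum c (pattern₁-next r))
                 (cong₂ _,_ (shifted-sum c (pattern₂-next r)) (shifted-sum c (pattern₃-next r)))

  -- The phase advances by exactly one at each step, starting from 001 at phase 0; the constant
  -- stays existential because only the phase is compared later.
  orbit : ∀ n → ∃ λ c → D^ n (0 mod m , 0 mod m , 1 mod m) ≡ shifted c (n mod 6)
  orbit zero = 0 , refl
  orbit (suc n) with c , eq ← orbit n = c + c + carry (n mod 6) ,
    trans (cong D eq) (trans (D-shifted c (n mod 6)) (cong (shifted _) (next-mod n)))

  -- Adding the first congruence to the reverse of the second puts `c + d` on both sides, where it
  -- cancels although `c` and `d` are unrelated.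
  cross-sums-equal : 3 ≤ m → ∀ c d {p p′ q q′} → p ≤ 1 → p′ ≤ 1 → q ≤ 1 → q′ ≤ 1 →
    (c + p) mod m ≡ (d + q) mod m → (c + p′) mod m ≡ (d + q′) mod m →
    p + q′ ≡ q + p′
  cross-sums-equal 3≤m c d {p} {p′} {q} {q′} p≤1 p′≤1 q≤1 q′≤1 eq eq′ = begin
    p + q′          ≡⟨ m<n⇒m%n≡m (small p≤1 q′≤1) ⟨
    (p + q′) % m    ≡⟨ %-+-cancelˡ (c + d) crossed ⟩
    (q + p′) % m    ≡⟨ m<n⇒m%n≡m (small q≤1 p′≤1) ⟩
    q + p′          ∎
    where
    open ≡-Reasoning
    small : ∀ {a b} → a ≤ 1 → b ≤ 1 → a + b < m
    -- `3 ≤ m` is by definition `2 < m`, and 2 is the largest possible sum.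
    small a≤1 b≤1 = ≤-<-trans (+-mono-≤ a≤1 b≤1) 3≤m
    group : ∀ c d p q → c + d + (p + q) ≡ c + p + (d + q)
    group = solve-∀
    group′ : ∀ c d q p → d + q + (c + p) ≡ c + d + (q + p)
    group′ = solve-∀
    crossed : (c + d + (p + q′)) % m ≡ (c + d + (q + p′)) % m
    crossed = begin
      (c + d + (p + q′)) % m    ≡⟨ cong (_% m) (group c d p q′) ⟩
      (c + p + (d + q′)) % m    ≡⟨ %-+-cong {a = c + p} {a′ = d + q} (mod≡⇒%≡ eq) (sym (mod≡⇒%≡ eq′)) ⟩
      (d + q + (c + p′)) % m    ≡⟨ cong (_% m) (group′ c d q p′) ⟩
      (c + d + (q + p′)) % m    ∎

  shifted-injective : 3 ≤ m → ∀ c d r s → shifted c r ≡ shifted d s → r ≡ s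
  shifted-injective 3≤m c d r s eq
    with eq₁ , eq₂₃ ← ,-injective eq
    with eq₂ , eq₃ ← ,-injective eq₂₃ =
    patterns-determine-phase r s
      (cross-sums-equal 3≤m c d (pattern₁≤1 r) (pattern₂≤1 r) (pattern₁≤1 s) (pattern₂≤1 s) eq₁ eq₂)
      (cross-sums-equal 3≤m c d (pattern₂≤1 r) (pattern₃≤1 r) (pattern₂≤1 s) (pattern₃≤1 s) eq₂ eq₃)

  repeats⇒6∣ : 3 ≤ m → ∀ k → EventuallyRepeats (0 mod m , 0 mod m , 1 mod m) k → 6 ∣ k
  repeats⇒6∣ 3≤m k (l , eq)
    with c , eqₗ₊ₖ ← orbit (l + k)
    with d , eqₗ ← orbit l =
    -- Equal phases mean `l + k` and `l + 0` agree mod 6; cancelling `l` leaves `k % 6 ≡ 0`.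
    m%n≡0⇒n∣m k 6 (%-+-cancelˡ l (trans (mod≡⇒%≡ {a = l + k} {b = l} phase)
                                        (cong (_% 6) (sym (+-identityʳ l)))))
    where
    phase : (l + k) mod 6 ≡ l mod 6
    phase = shifted-injective 3≤m c d _ _ (trans (sym eqₗ₊ₖ) (trans eq eqₗ))

theorem3p5 : (m : ℕ) .{{_ : NonZero m}} → 3 ≤ m → 6 ∣ P₃ m
theorem3p5 m 3≤m = repeats⇒6∣ 3≤m (P₃ m) (IsPeriod.repeats (Per-isPeriod _))
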